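{- Let $0\le r\le n$ and $[\tilde n]=\{0,1,\dots,n\}$. Let $\Omega$ be the set of $\bar u\in\mathbb P(\mathbb T^{\binom{[\tilde n]}{r+1}})$ such that $u_I\ne\infty$ for some $I\ni0$ and $u_J\neq\infty$ for some $J\not\ni0$, and let $\pi:\Omega\to\mathbb P(\mathbb T^{\binom{[n]}{r}})\times\mathbb P(\mathbb T^{\binom{[n]}{r+1}})$ be $\bar u\mapsto\big(\overline{(u_{I\setminus0})_{I\ni0}},\overline{(u_I)_{I\not\ni0}}\big)$. Then $\pi$ maps $\Omega\cap Dr(r+1;n+1)$ onto $FlDr(r,r+1;n)$, and for each point $(\overline{\mu'},\overline\mu)\in FlDr(r,r+1;n)$ the fiber of $\pi|_{\Omega\cap Dr(r+1;n+1)}$ over it is the set of classes of $a\odot\mu'\oplus b\odot\mu$ with $a,b\in\mathbb R$, each of which lies in $Dr(r+1;n+1)$; this fiber is in bijection with $\mathbb R^2/\mathbb R(1,1)$. Here $\mu'$ and $\mu$ are regarded as elements of $\mathbb T^{\binom{[\tilde n]}{r+1}}$ via $\mu'(I)=\mu'(I\setminus0)$ if $0\in I$ and $\infty$ otherwise, and $\mu(J)=\mu(J)$ if $0\notin J$ and $\infty$ otherwise.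
   Context: $\mathbb T=\mathbb R\cup\{\infty\}$ with $a\odot b=a+b$, $a\oplus b=\min(a,b)$ (applied coordinatewise to vectors). $\mathbb P(\mathbb T^E)$ is $\mathbb T^E$ minus the all-$\infty$ vector, modulo $u\sim u+c\mathbf 1$, $c\in\mathbb R$; $\bar u$ is the class of $u$. "The minimum is attained at least twice" holds by convention when all entries are $\infty$. Tropical Grassmann–Plücker relations for $p\in\mathbb T^{\binom{E}{r}}$: for all $I,J\in\binom{E}{r}$ with $|I\cap J|<r-1$ and $i\in I\setminus J$, the minimum of $\{p(I)+p(J)\}\cup\{p(I\setminus i\cup j)+p(J\setminus j\cup i):j\in J\setminus I\}$ is attained at least twice. The Dressian $Dr(r+1;n+1)\subseteq\mathbb P(\mathbb T^{\binom{[\tilde n]}{r+1}})$ is the set of classes satisfying these relations (with $E=[\tilde n]$, rank $r+1$). Tropical incidence–Plücker relations for $(p,q)\in\mathbb T^{\binom{[n]}{r}}\times\mathbb T^{\binom{[n]}{s}}$, $r\le s$: for all $I'\in\binom{[n]}{r-1}$, $J'\in\binom{[n]}{s+1}$, the minimum of $\{p(I'\cup j)+q(J'\setminus j):j\in J'\setminus I'\}$ is attained at least twice. $FlDr(r,r+1;n)\subseteq\mathbb P(\mathbb T^{\binom{[n]}{r}})\times\mathbb P(\mathbb T^{\binom{[n]}{r+1}})$ is the set of $(\bar p,\bar q)$ with $p$ and $q$ satisfying their Grassmann–Plücker relations and $(p,q)$ satisfying the incidence–Plücker relations. -}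

module Defs where

open import Level using (0ℓ)
open import Data.Nat using (ℕ; zero; suc; _<_)
open import Data.Bool using (Bool; true; false)
open import Data.Maybe using (Maybe; just; nothing)
open import Data.Fin using (Fin)
open import Data.Fin.Subset using (Subset; _∈_; _∉_; _∩_; _∪_; _-_; ⁅_⁆; ∣_∣)
open import Data.Fin.Subset.Properties using (_∈?_)
open import Data.List using (List; []; _∷_; map; filter; length; lookup; allFin)
open import Data.List.Relation.Unary.All using (All)
open import Data.Vec using (_∷_)
open import Data.Product using (Σ; ∃; ∃₂; _×_; _,_)
open import Data.Empty using (⊥)
open import Data.Unit using (⊤)
open import Relation.Nullary using (¬_; ¬?)
open import Relation.Nullary.Decidable using (_×-dec_)
open import Relation.Binary.PropositionalEquality using (_≡_; _≢_)
open import Relation.Binary.Structures using (IsDecTotalOrder)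
open import Algebra.Structures using (IsAbelianGroup)

-- The value group of the tropical semifield.  The paper uses (ℝ, +, ≤);
-- we state the theorem for every linearly ordered abelian group
-- (ℝ is an instance).

record LinOrdAbGroup : Set₁ where
  infixl 6 _+_
  infix 4 _≤_
  field
    Carrier        : Set
    _+_            : Carrier → Carrier → Carrier
    0#             : Carrier
    neg            : Carrier → Carrier
    _≤_            : Carrier → Carrier → Set
    isAbelianGroup : IsAbelianGroup _≡_ _+_ 0# neg
    isDecTotalOrder : IsDecTotalOrder _≡_ _≤_
    +-monoˡ-≤      : ∀ {x y} z → x ≤ y → x + z ≤ y + z

module Tropical (G : LinOrdAbGroup) where
  open LinOrdAbGroup G public

  𝕋 : Set
  𝕋 = Maybe Carrier

  ∞ : 𝕋
  ∞ = nothing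

  infixl 7 _⊙_
  infixl 6 _⊕_
  infix 4 _≤𝕋_

  _⊙_ : 𝕋 → 𝕋 → 𝕋
  just x ⊙ just y = just (x + y)
  _      ⊙ _      = nothing

  _≤𝕋_ : 𝕋 → 𝕋 → Set
  _      ≤𝕋 nothing = ⊤
  nothing ≤𝕋 just _ = ⊥
  just x ≤𝕋 just y  = x ≤ y

  _⊕_ : 𝕋 → 𝕋 → 𝕋
  nothing ⊕ y = y
  just x ⊕ nothing = just x
  just x ⊕ just y with IsDecTotalOrder._≤?_ isDecTotalOrder x y
  ... | Relation.Nullary.yes _ = just x
  ... | Relation.Nullary.no  _ = just y

  -- "the minimum of the list is attained at least twice"
  -- (by convention true when all entries are ∞)
  MinTwice : List 𝕋 → Set
  MinTwice xs =
    All (_≡ ∞) xs ⊎'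
    (Σ (Fin (length xs)) λ i → Σ (Fin (length xs)) λ j →
       i ≢ j × lookup xs i ≡ lookup xs j × (∀ k → lookup xs i ≤𝕋 lookup xs k))
    where
      open import Data.Sum using () renaming (_⊎_ to _⊎'_)

  -- A vector in 𝕋^(E choose k), E = Fin m, is represented by a function
  -- on all subsets of E; only its values on k-subsets are ever used.
  Vect : ℕ → Set
  Vect m = Subset m → 𝕋

  _≈[_]_ : ∀ {m} → Vect m → ℕ → Vect m → Set
  u ≈[ k ] v = Σ Carrier λ c → ∀ I → ∣ I ∣ ≡ k → u I ≡ just c ⊙ v I

  NotAllInf : ∀ {m} → ℕ → Vect m → Set
  NotAllInf k u = Σ _ λ I → ∣ I ∣ ≡ k × u I ≢ ∞

  GP : ∀ {m} → ℕ → Vect m → Set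
  GP {m} k p =
    ∀ I J → ∣ I ∣ ≡ k → ∣ J ∣ ≡ k → suc ∣ I ∩ J ∣ < k →
    ∀ i → i ∈ I → i ∉ J →
    MinTwice (p I ⊙ p J ∷
      map (λ j → p ((I - i) ∪ ⁅ j ⁆) ⊙ p ((J - j) ∪ ⁅ i ⁆))
          (filter (λ j → (j ∈? J) ×-dec ¬? (j ∈? I)) (allFin m)))

  IP : ∀ {m} → ℕ → ℕ → Vect m → Vect m → Set
  IP {m} r s p q =
    ∀ I' J' → suc ∣ I' ∣ ≡ r → ∣ J' ∣ ≡ suc s →
    MinTwice (map (λ j → p (I' ∪ ⁅ j ⁆) ⊙ q (J' - j))
                  (filter (λ j → (j ∈? J') ×-dec ¬? (j ∈? I')) (allFin m)))

  Dr : (m k : ℕ) → Vect m → Set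
  Dr m k u = NotAllInf k u × GP k u

  FlDr : (n r : ℕ) → Vect n → Vect n → Set
  FlDr n r p q =
    NotAllInf r p × NotAllInf (suc r) q × GP r p × GP (suc r) q × IP r (suc r) p q

  -- Subsets of [ñ] = {0,…,n} are Fin (suc n); element 0 is Fin.zero and
  -- j ∈ [n] = {1,…,n} corresponds to Fin.suc.  A subset is b ∷ S where
  -- b says whether 0 ∈ I and S = I ∖ 0 ⊆ [n].

  Ω : (n r : ℕ) → Vect (suc n) → Set
  Ω n r u =
    (Σ (Subset n) λ S → ∣ S ∣ ≡ r × u (true ∷ S) ≢ ∞) ×
    (Σ (Subset n) λ S → ∣ S ∣ ≡ suc r × u (false ∷ S) ≢ ∞)

  πp : ∀ {n} → Vect (suc n) → Vect n
  πp u S = u (true ∷ S)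

  πq : ∀ {n} → Vect (suc n) → Vect n
  πq u S = u (false ∷ S)

  lift′ : ∀ {n} → Vect n → Vect (suc n)
  lift′ μ′ (true ∷ S)  = μ′ S
  lift′ μ′ (false ∷ S) = ∞

  lift : ∀ {n} → Vect n → Vect (suc n)
  lift μ (true ∷ S)  = ∞
  lift μ (false ∷ S) = μ S

  comb : ∀ {n} → Carrier → Carrier → Vect n → Vect n → Vect (suc n)
  comb a b μ′ μ I = just a ⊙ lift′ μ′ I ⊕ just b ⊙ lift μ I

{-# OPTIONS --safe #-}
module Submission where

-- Write A + j = A ∪ {j} and B − j = B ∖ {j}.  All the Plücker-type relations say that, for
-- given A and B, the minimum over j ∈ B ∖ A of p(A + j) + q(B − j) is never attained exactly
-- once.
-- For u on {0,…,n} the relations with 0 ∈ A ∩ B, 0 ∉ A ∪ B and 0 ∈ A ∖ B are, respectively,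
-- the Grassmann–Plücker relations of μ′ and of μ and the incidence relations of (μ′, μ), so
-- everything comes down to deriving the remaining case 0 ∈ B ∖ A from these three.
--
-- Given a finite term at e and some element of A ∖ B, replace B by B′ = B − v + i with
-- i ∈ A ∖ B, v ∈ B ∖ (A + e), u(B′ − e) finite and u(A + v) + u(B′ − e) minimal among the
-- choices of v.  By induction on A ∖ B the relation for (A, B′) gives a term at some j not
-- larger than the one at e, and the three-term relation exchanging {v, j} and {e, i} in B − e
-- carries this back to B: the term at j or the term at v is at most the one at e.
-- Three-term relations are always among the known ones, since they are invariant under
-- renaming the four elements exchanged.

open import Defs
open import Level using (0ℓ)
open import Data.Nat using (ℕ; suc; _<_; s≤s) renaming (_≤_ to _ℕ≤_)
import Data.Nat.Properties as ℕₚ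
open import Data.Bool using (true; false)
open import Data.Maybe using (just; nothing)
open import Data.Maybe.Properties using (just-injective)
open import Data.Fin using (Fin; zero; suc; _≟_)
open import Data.Fin.Properties using (suc-injective)
open import Data.Fin.Subset using (Subset; _∈_; _∉_; _⊆_; _⊂_; _∩_; _∪_; _─_; _-_; ⁅_⁆; ∣_∣)
open import Data.Fin.Subset.Induction using (⊂-wellFounded)
open import Data.Fin.Subset.Properties using (_∈?_; nonempty?; drop-there; ⊆-antisym; p⊆q⇒∣p∣≤∣q∣; p⊂q⇒∣p∣<∣q∣; x∈p∩q⁻; x∈p∧x∉q⇒x∈p─q; ∪-identityʳ; p─⊥≡p)
open import Data.List using (List; []; _∷_; map; filter; length; allFin) renaming (lookup to lookupˡ)
open import Data.List.Properties using (map-cong; map-cong-local)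
open import Data.List.Relation.Unary.All using (All; []; _∷_)
import Data.List.Relation.Unary.All as All
open import Data.List.Relation.Unary.All.Properties using () renaming (map⁺ to All-map⁺)
open import Data.List.Relation.Unary.Any using (here; there)
open import Data.List.Relation.Unary.Unique.Propositional using (Unique; []; _∷_)
open import Data.List.Relation.Unary.Unique.Propositional.Properties using (allFin⁺; filter⁺)
open import Data.List.Membership.Propositional using () renaming (_∈_ to _∈ˡ_)
open import Data.List.Membership.Propositional.Properties using (∈-filter⁺; ∈-filter⁻; ∈-allFin)
open import Data.Vec using (_∷_; _[_]≔_; here; there; lookup)
open import Data.Vec.Properties using ([]≔-idempotent; []≔-commutes; []≔-updates; []≔-minimal; []≔-lookup; []=⇒lookup; lookup⇒[]=; lookup∘updateAt; lookup∘updateAt′)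
open import Data.Product using (Σ; ∃; _×_; _,_; proj₁; proj₂)
open import Data.Sum using (_⊎_; inj₁; inj₂; swap; [_,_]′)
open import Data.Unit using (tt)
open import Relation.Nullary using (Dec; yes; no; contradiction)
open import Relation.Nullary.Decidable using (_×-dec_; ¬?; decidable-stable)
open import Relation.Binary.PropositionalEquality using (_≡_; _≢_; refl; sym; trans; cong; cong₂; subst; subst₂; ≢-sym; isEquivalence; module ≡-Reasoning)
open import Relation.Binary.Structures using (IsDecTotalOrder)
open import Relation.Binary.Definitions using (DecidableEquality)
open import Algebra.Structures using (IsAbelianGroup)
open import Algebra.Bundles using (CommutativeMonoid)
import Algebra.Properties.CommutativeSemigroup as CommSemigroupProperties
open import Induction.WellFounded using (Acc; acc)
open import Function using (_∘_)
open import Function.Bundles using (_⇔_; mk⇔)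

-- Inserting and deleting single elements of a subset.

private variable
  m : ℕ
  A B S : Subset m
  i j x : Fin m

infixl 6 _⊞_ _⊟_

-- As vector updates, iterated insertions and deletions obey simple commutation laws; `∪⁅⁆≡⊞` and
-- `-≡⊟` relate them to the sets in the Plücker relations.
_⊞_ : Subset m → Fin m → Subset m
S ⊞ j = S [ j ]≔ true

_⊟_ : Subset m → Fin m → Subset m
S ⊟ j = S [ j ]≔ false

∪⁅⁆≡⊞ : ∀ (S : Subset m) j → S ∪ ⁅ j ⁆ ≡ S ⊞ j
∪⁅⁆≡⊞ (true  ∷ S) zero    = cong (true ∷_) (∪-identityʳ S)
∪⁅⁆≡⊞ (false ∷ S) zero    = cong (true ∷_) (∪-identityʳ S)
∪⁅⁆≡⊞ (true  ∷ S) (suc j) = cong (true ∷_) (∪⁅⁆≡⊞ S j)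
∪⁅⁆≡⊞ (false ∷ S) (suc j) = cong (false ∷_) (∪⁅⁆≡⊞ S j)

-≡⊟ : ∀ (S : Subset m) j → S - j ≡ S ⊟ j
-≡⊟ (b ∷ S) zero    = cong (false ∷_) (p─⊥≡p S)
-≡⊟ (b ∷ S) (suc j) = cong (b ∷_) (-≡⊟ S j)

∈⇒≢ : i ∈ S → j ∉ S → i ≢ j
∈⇒≢ i∈S j∉S refl = j∉S i∈S

j∈S⊞j : ∀ (S : Subset m) j → j ∈ S ⊞ j
j∈S⊞j = []≔-updates

j∉S⊟j : ∀ (S : Subset m) j → j ∉ S ⊟ j
j∉S⊟j S j p with () ← trans (sym ([]=⇒lookup p)) (lookup∘updateAt j S)

∈⊟⁺ : x ∈ S → x ≢ j → x ∈ S ⊟ j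
∈⊟⁺ x∈S x≢j = []≔-minimal _ _ _ x≢j x∈S

∈⊟⁻ : ∀ (S : Subset m) j → x ∈ S ⊟ j → x ∈ S
∈⊟⁻ {x = x} S j p with x ≟ j
... | yes refl = contradiction p (j∉S⊟j S j)
... | no  x≢j  = lookup⇒[]= x S (trans (sym (lookup∘updateAt′ x j x≢j S)) ([]=⇒lookup p))

∈⊞⁺ : ∀ j → x ∈ S → x ∈ S ⊞ j
∈⊞⁺ {x = x} {S = S} j x∈S with x ≟ j
... | yes refl = j∈S⊞j S j
... | no  x≢j  = []≔-minimal _ _ _ x≢j x∈S

∈⊞⁻ : x ∈ S ⊞ j → x ≢ j → x ∈ S
∈⊞⁻ {x = x} {S = S} {j = j} p x≢j =
  lookup⇒[]= x S (trans (sym (lookup∘updateAt′ x j x≢j S)) ([]=⇒lookup p))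

∉⊞⁺ : x ∉ S → x ≢ j → x ∉ S ⊞ j
∉⊞⁺ x∉S x≢j x∈ = x∉S (∈⊞⁻ x∈ x≢j)

∉⊟⁺ : ∀ j → x ∉ S → x ∉ S ⊟ j
∉⊟⁺ j x∉S x∈ = x∉S (∈⊟⁻ _ j x∈)

∉⊟⁻ : x ∉ S ⊟ j → x ≢ j → x ∉ S
∉⊟⁻ x∉ x≢j x∈S = x∉ (∈⊟⁺ x∈S x≢j)

∉⊞⁻ : x ∉ S ⊞ j → x ≢ j × x ∉ S
∉⊞⁻ x∉ = (λ { refl → x∉ (j∈S⊞j _ _) }) , x∉ ∘ ∈⊞⁺ _

⊟-⊞ : j ∈ S → S ⊟ j ⊞ j ≡ S
⊟-⊞ {j = j} {S = S} j∈S = begin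
  S ⊟ j ⊞ j            ≡⟨ []≔-idempotent S j ⟩
  S [ j ]≔ true        ≡⟨ cong (S [ j ]≔_) ([]=⇒lookup j∈S) ⟨
  S [ j ]≔ lookup S j  ≡⟨ []≔-lookup S j ⟩
  S                    ∎
  where open ≡-Reasoning

⊞-⊟ : j ∉ S → S ⊞ j ⊟ j ≡ S
⊞-⊟ {j = j} {S = S} j∉S with lookup S j in eq
... | true  = contradiction (lookup⇒[]= j S eq) j∉S
... | false = begin
  S ⊞ j ⊟ j            ≡⟨ []≔-idempotent S j ⟩
  S [ j ]≔ false       ≡⟨ cong (S [ j ]≔_) eq ⟨
  S [ j ]≔ lookup S j  ≡⟨ []≔-lookup S j ⟩
  S                    ∎
  where open ≡-Reasoning

∣⊞∣ : j ∉ S → ∣ S ⊞ j ∣ ≡ suc ∣ S ∣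
∣⊞∣ {j = zero}  {S = true  ∷ S} j∉S = contradiction here j∉S
∣⊞∣ {j = zero}  {S = false ∷ S} j∉S = refl
∣⊞∣ {j = suc j} {S = true  ∷ S} j∉S = cong suc (∣⊞∣ (j∉S ∘ there))
∣⊞∣ {j = suc j} {S = false ∷ S} j∉S = ∣⊞∣ (j∉S ∘ there)

∣⊟∣ : j ∈ S → suc ∣ S ⊟ j ∣ ≡ ∣ S ∣
∣⊟∣ {j = j} {S = S} j∈S = trans (sym (∣⊞∣ (j∉S⊟j S j))) (cong ∣_∣ (⊟-⊞ j∈S))

∣⊟⊞∣ : i ∈ S → j ∉ S → ∣ S ⊟ i ⊞ j ∣ ≡ ∣ S ∣
∣⊟⊞∣ {i = i} i∈S j∉S = trans (∣⊞∣ (∉⊟⁺ i j∉S)) (∣⊟∣ i∈S)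

-- Differences, inclusions and cardinalities.

∈─⁻ : ∀ (A B : Subset m) → x ∈ A ─ B → x ∈ A × x ∉ B
∈─⁻ {x = zero}  (a ∷ A) (false ∷ B) here      = here , λ ()
∈─⁻ {x = suc x} (a ∷ A) (b ∷ B)     (there p) with ∈─⁻ A B p
... | x∈A , x∉B = there x∈A , x∉B ∘ drop-there

⊆⊎∃∉ : ∀ (A B : Subset m) → A ⊆ B ⊎ ∃ λ x → x ∈ A × x ∉ B
⊆⊎∃∉ A B with nonempty? (A ─ B)
... | yes (x , x∈) = inj₂ (x , ∈─⁻ A B x∈)
... | no  ¬ne      = inj₁ λ {x} x∈A →
  decidable-stable (x ∈? B) λ x∉B → ¬ne (x , x∈p∧x∉q⇒x∈p─q x∈A x∉B)

∣∣<⇒∃∉ : ∀ (A B : Subset m) → ∣ A ∣ < ∣ B ∣ → ∃ λ x → x ∈ B × x ∉ A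
∣∣<⇒∃∉ A B A<B with ⊆⊎∃∉ B A
... | inj₁ B⊆A = contradiction (p⊆q⇒∣p∣≤∣q∣ B⊆A) (ℕₚ.<⇒≱ A<B)
... | inj₂ p   = p

⊆∧∣∣≡⇒≡ : A ⊆ B → ∣ A ∣ ≡ ∣ B ∣ → A ≡ B
⊆∧∣∣≡⇒≡ {A = A} {B = B} A⊆B eq with ⊆⊎∃∉ B A
... | inj₁ B⊆A = ⊆-antisym A⊆B B⊆A
... | inj₂ p   = contradiction (p⊂q⇒∣p∣<∣q∣ (A⊆B , p)) (ℕₚ.<-irrefl eq)

-- The measure of the inductions in `augment` and `relation`: the exchange puts `i` into `B`, and
-- the element `j` that it loses was never in `A`.
─-⊂ : i ∈ A → i ∉ B → j ∉ A → A ─ (B ⊟ j ⊞ i) ⊂ A ─ B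
─-⊂ {i = i} {A = A} {B = B} {j = j} i∈A i∉B j∉A = sub , i , x∈p∧x∉q⇒x∈p─q i∈A i∉B , gone
  where
  sub : A ─ (B ⊟ j ⊞ i) ⊆ A ─ B
  sub x∈ with x∈A , x∉ ← ∈─⁻ A _ x∈ =
    x∈p∧x∉q⇒x∈p─q x∈A λ x∈B → x∉ (∈⊞⁺ i (∈⊟⁺ x∈B (∈⇒≢ x∈A j∉A)))
  gone : i ∉ A ─ (B ⊟ j ⊞ i)
  gone i∈ = proj₂ (∈─⁻ A _ i∈) (j∈S⊞j (B ⊟ j) i)

⊞-⊆ : A ⊆ B → j ∈ B → A ⊞ j ⊆ B
⊞-⊆ {j = j} A⊆B j∈B {w} w∈ with w ≟ j
... | yes refl = j∈B
... | no  w≢j  = A⊆B (∈⊞⁻ w∈ w≢j)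

⊟⊞⊟-commutes : ∀ {k : Fin m} → i ≢ k → j ≢ k → S ⊟ j ⊞ i ⊟ k ≡ S ⊟ k ⊟ j ⊞ i
⊟⊞⊟-commutes {i = i} {j = j} {S = S} {k} i≢k j≢k =
  trans ([]≔-commutes (S ⊟ j) i k i≢k) (cong (_⊞ i) ([]≔-commutes S j k j≢k))

-- Order and arithmetic of the tropical semifield.

module TropicalExchange (G : LinOrdAbGroup) where
  open Tropical G
  open IsAbelianGroup isAbelianGroup using (assoc; comm; identityˡ; inverseˡ)
  private module ≤ = IsDecTotalOrder isDecTotalOrder

  +-monoʳ-≤ : ∀ {x y} z → x ≤ y → z + x ≤ z + y
  +-monoʳ-≤ {x} {y} z x≤y = subst₂ _≤_ (comm x z) (comm y z) (+-monoˡ-≤ z x≤y)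

  neg-cancel : ∀ z x → neg z + (z + x) ≡ x
  neg-cancel z x = trans (sym (assoc _ _ _)) (trans (cong (_+ x) (inverseˡ z)) (identityˡ x))

  ≤𝕋-refl : ∀ x → x ≤𝕋 x
  ≤𝕋-refl nothing  = tt
  ≤𝕋-refl (just x) = ≤.refl

  ≤𝕋-trans : ∀ x y z → x ≤𝕋 y → y ≤𝕋 z → x ≤𝕋 z
  ≤𝕋-trans _        _        nothing  _   _   = tt
  ≤𝕋-trans (just _) (just _) (just _) x≤y y≤z = ≤.trans x≤y y≤z

  ≤𝕋-reflexive : ∀ {x y} → x ≡ y → x ≤𝕋 y
  ≤𝕋-reflexive {x} refl = ≤𝕋-refl x

  ≤𝕋-antisym : ∀ {x y} → x ≤𝕋 y → y ≤𝕋 x → x ≡ y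
  ≤𝕋-antisym {just _}  {just _}  x≤y y≤x = cong just (≤.antisym x≤y y≤x)
  ≤𝕋-antisym {nothing} {nothing} _   _   = refl

  ≤𝕋-total : ∀ x y → x ≤𝕋 y ⊎ y ≤𝕋 x
  ≤𝕋-total x        nothing  = inj₁ tt
  ≤𝕋-total nothing  (just y) = inj₂ tt
  ≤𝕋-total (just x) (just y) = ≤.total x y

  ∞? : ∀ (x : 𝕋) → Dec (x ≡ ∞)
  ∞? nothing  = yes refl
  ∞? (just _) = no λ ()

  ≤𝕋-finite : ∀ {x y} → x ≤𝕋 y → y ≢ ∞ → x ≢ ∞
  ≤𝕋-finite {y = nothing} _  y≢∞ _    = y≢∞ refl
  ≤𝕋-finite {y = just _}  () y≢∞ refl

  ⊙-comm : ∀ x y → x ⊙ y ≡ y ⊙ x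
  ⊙-comm (just x) (just y) = cong just (comm x y)
  ⊙-comm (just x) nothing  = refl
  ⊙-comm nothing  (just y) = refl
  ⊙-comm nothing  nothing  = refl

  ⊙-assoc : ∀ x y z → (x ⊙ y) ⊙ z ≡ x ⊙ (y ⊙ z)
  ⊙-assoc (just x) (just y) (just z) = cong just (assoc x y z)
  ⊙-assoc (just x) (just y) nothing  = refl
  ⊙-assoc (just x) nothing  z        = refl
  ⊙-assoc nothing  y        z        = refl

  ⊙-identityˡ : ∀ x → just 0# ⊙ x ≡ x
  ⊙-identityˡ (just x) = cong just (identityˡ x)
  ⊙-identityˡ nothing  = refl

  ⊙-identityʳ : ∀ x → x ⊙ just 0# ≡ x
  ⊙-identityʳ x = trans (⊙-comm x _) (⊙-identityˡ x)

  ⊙-commutativeMonoid : CommutativeMonoid 0ℓ 0ℓ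
  ⊙-commutativeMonoid = record
    { isCommutativeMonoid = record
      { isMonoid = record
        { isSemigroup = record
          { isMagma = record { isEquivalence = isEquivalence ; ∙-cong = cong₂ _⊙_ }
          ; assoc = ⊙-assoc }
        ; identity = ⊙-identityˡ , ⊙-identityʳ }
      ; comm = ⊙-comm } }

  open CommSemigroupProperties (CommutativeMonoid.commutativeSemigroup ⊙-commutativeMonoid)
    using (x∙yz≈y∙xz; x∙yz≈z∙yx; interchange)

  ⊙-finite⁺ : ∀ {x y} → x ≢ ∞ → y ≢ ∞ → x ⊙ y ≢ ∞
  ⊙-finite⁺ {just _}  {just _}  _   _   ()
  ⊙-finite⁺ {just _}  {nothing} _   y≢∞ _ = y≢∞ refl
  ⊙-finite⁺ {nothing} {_}       x≢∞ _   _ = x≢∞ refl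

  ⊙-finite⁻ : ∀ {x y} → x ⊙ y ≢ ∞ → x ≢ ∞ × y ≢ ∞
  ⊙-finite⁻ {just _}  {just _}  _ = (λ ()) , λ ()
  ⊙-finite⁻ {just _}  {nothing} p = contradiction refl p
  ⊙-finite⁻ {nothing} {_}       p = contradiction refl p

  ⊙-monoʳ-≤ : ∀ z {x y} → x ≤𝕋 y → z ⊙ x ≤𝕋 z ⊙ y
  ⊙-monoʳ-≤ nothing                      _   = tt
  ⊙-monoʳ-≤ (just z) {y = nothing}       _   = tt
  ⊙-monoʳ-≤ (just z) {just x} {just y}   x≤y = +-monoʳ-≤ z x≤y

  ⊙-cancelˡ-≤ : ∀ z {x y} → z ≢ ∞ → z ⊙ x ≤𝕋 z ⊙ y → x ≤𝕋 y
  ⊙-cancelˡ-≤ nothing                    z≢∞ _ = contradiction refl z≢∞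
  ⊙-cancelˡ-≤ (just z) {y = nothing}     _   _ = tt
  ⊙-cancelˡ-≤ (just z) {just x} {just y} _   p =
    subst₂ _≤_ (neg-cancel z x) (neg-cancel z y) (+-monoʳ-≤ (neg z) p)

  -- The minimum attained twice, in terms of elements instead of positions.

  module _ {A : Set} (g : A → 𝕋) where

    argmin : ∀ {x} (xs : List A) → x ∈ˡ xs →
             ∃ λ v → v ∈ˡ xs × ∀ {y} → y ∈ˡ xs → g v ≤𝕋 g y
    argmin (x ∷ [])     _ = x , here refl , λ { (here refl) → ≤𝕋-refl (g x) }
    argmin (x ∷ y ∷ ys) _ with argmin (y ∷ ys) (here refl)
    ... | v , v∈ , min with ≤𝕋-total (g x) (g v)
    ... | inj₁ x≤v = x , here refl , λ
      { (here refl) → ≤𝕋-refl (g x) ; {w} (there w∈) → ≤𝕋-trans (g x) (g v) (g w) x≤v (min w∈) }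
    ... | inj₂ v≤x = v , there v∈ , λ
      { (here refl) → v≤x ; (there w∈) → min w∈ }

    private
      Index : List A → Set
      Index xs = Fin (length (map g xs))

    elt : ∀ xs → Index xs → A
    elt (x ∷ xs) zero    = x
    elt (x ∷ xs) (suc k) = elt xs k

    elt∈ : ∀ xs k → elt xs k ∈ˡ xs
    elt∈ (x ∷ xs) zero    = here refl
    elt∈ (x ∷ xs) (suc k) = there (elt∈ xs k)

    lookup-elt : ∀ xs k → lookupˡ (map g xs) k ≡ g (elt xs k)
    lookup-elt (x ∷ xs) zero    = refl
    lookup-elt (x ∷ xs) (suc k) = lookup-elt xs k

    elt-injective : ∀ {xs} → Unique xs → ∀ k l → elt xs k ≡ elt xs l → k ≡ l
    elt-injective {_ ∷ _} _        zero    zero    _  = refl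
    elt-injective {_ ∷ _} (p ∷ _)  zero    (suc l) eq = contradiction eq (All.lookup p (elt∈ _ l))
    elt-injective {_ ∷ _} (p ∷ _)  (suc k) zero    eq = contradiction (sym eq) (All.lookup p (elt∈ _ k))
    elt-injective {_ ∷ _} (_ ∷ us) (suc k) (suc l) eq = cong suc (elt-injective us k l eq)

    pos : ∀ {x xs} → x ∈ˡ xs → Index xs
    pos (here _)  = zero
    pos (there p) = suc (pos p)

    elt-pos : ∀ {x xs} (p : x ∈ˡ xs) → elt xs (pos p) ≡ x
    elt-pos (here refl) = refl
    elt-pos (there p)   = elt-pos p

    lookup-pos : ∀ {x xs} (p : x ∈ˡ xs) → lookupˡ (map g xs) (pos p) ≡ g x
    lookup-pos {xs = xs} p = trans (lookup-elt xs (pos p)) (cong g (elt-pos p))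

    -- A local form of `MinTwice`: it can be used at any finite entry, without first locating the
    -- minimum.
    NeverUniqueMin : List A → Set
    NeverUniqueMin xs = ∀ {i} → i ∈ˡ xs → g i ≢ ∞ → ∃ λ j → j ∈ˡ xs × j ≢ i × g j ≤𝕋 g i

    -- One of the two minimal positions does not carry `i`; that different positions carry different
    -- elements is where `Unique` enters.
    MinTwice⇒ : DecidableEquality A → ∀ {xs} → Unique xs → MinTwice (map g xs) → NeverUniqueMin xs
    MinTwice⇒ _≟ᴬ_ {xs} un (inj₁ all∞) {i} i∈ fin =
      contradiction (trans (sym (lookup-pos i∈)) (all∞-at (map g xs) all∞ (pos i∈))) fin
      where
      all∞-at : ∀ ys → All (_≡ ∞) ys → ∀ k → lookupˡ ys k ≡ ∞
      all∞-at (y ∷ ys) (p ∷ ps) zero    = p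
      all∞-at (y ∷ ys) (p ∷ ps) (suc k) = all∞-at ys ps k
    MinTwice⇒ _≟ᴬ_ {xs} un (inj₂ (k , l , k≢l , eq , min)) {i} i∈ fin with elt xs k ≟ᴬ i
    ... | no  k≢i = elt xs k , elt∈ xs k , k≢i , subst₂ _≤𝕋_ (lookup-elt xs k) (lookup-pos i∈) (min (pos i∈))
    ... | yes k≡i = elt xs l , elt∈ xs l , (λ l≡i → k≢l (elt-injective un k l (trans k≡i (sym l≡i)))) ,
                    subst₂ _≤𝕋_ (trans eq (lookup-elt xs l)) (lookup-pos i∈) (min (pos i∈))

    -- Applied at a minimal entry, the hypothesis yields a second entry that is no larger, hence
    -- equal. If the minimal entry is infinite, all are.
    ⇒MinTwice : ∀ xs → NeverUniqueMin xs → MinTwice (map g xs)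
    ⇒MinTwice []           _ = inj₁ []
    ⇒MinTwice xs@(x ∷ xs′) h with argmin xs (here refl)
    ... | v , v∈ , min with ∞? (g v)
    ... | yes v≡∞ = inj₁ (All-map⁺ (All.tabulate λ {y} y∈ → is∞ (subst (_≤𝕋 g y) v≡∞ (min y∈))))
      where
      is∞ : ∀ {y} → ∞ ≤𝕋 y → y ≡ ∞
      is∞ {nothing} _ = refl
    ... | no v≢∞ with w , w∈ , w≢v , w≤v ← h v∈ v≢∞ =
      inj₂ (pos v∈ , pos w∈ , (λ eq → w≢v (trans (sym (elt-pos w∈)) (trans (cong (elt xs) (sym eq)) (elt-pos v∈)))) ,
        trans (lookup-pos v∈) (trans (≤𝕋-antisym (min w∈) w≤v) (sym (lookup-pos w∈))) ,
        λ k → subst₂ _≤𝕋_ (sym (lookup-pos v∈)) (sym (lookup-elt xs k)) (min (elt∈ xs k)))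

  -- Exchange relations for a pair (A, B), and their translation to and from `IP` and `GP`.

  Rel : ∀ {m} → Vect m → Vect m → Subset m → Subset m → Set
  Rel p q A B = ∀ {i} → i ∈ B → i ∉ A → p (A ⊞ i) ⊙ q (B ⊟ i) ≢ ∞ →
    ∃ λ j → j ∈ B × j ∉ A × j ≢ i × p (A ⊞ j) ⊙ q (B ⊟ j) ≤𝕋 p (A ⊞ i) ⊙ q (B ⊟ i)

  module _ {m} (A B : Subset m) where

    -- Note the order of the arguments: these are the elements of B outside A.
    _∖_ : List (Fin m)
    _∖_ = filter (λ j → (j ∈? B) ×-dec ¬? (j ∈? A)) (allFin m)

    ∖-unique : Unique _∖_
    ∖-unique = filter⁺ _ (allFin⁺ m)

    ∈∖⁺ : ∀ {j} → j ∈ B → j ∉ A → j ∈ˡ _∖_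
    ∈∖⁺ j∈B j∉A = ∈-filter⁺ (λ j → (j ∈? B) ×-dec ¬? (j ∈? A)) (∈-allFin _) (j∈B , j∉A)

    ∈∖⁻ : ∀ {j} → j ∈ˡ _∖_ → j ∈ B × j ∉ A
    ∈∖⁻ j∈ = proj₂ (∈-filter⁻ (λ j → (j ∈? B) ×-dec ¬? (j ∈? A)) {xs = allFin m} j∈)

  IP⇒Rel : ∀ {m r s} (p q : Vect m) → IP r s p q →
           ∀ A B → suc ∣ A ∣ ≡ r → ∣ B ∣ ≡ suc s → Rel p q A B
  IP⇒Rel p q ip A B ∣A∣ ∣B∣ i∈B i∉A fin =
    let j , j∈ , rest = MinTwice⇒ _ _≟_ (∖-unique A B) (subst MinTwice terms (ip A B ∣A∣ ∣B∣))
                          (∈∖⁺ A B i∈B i∉A) fin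
        j∈B , j∉A = ∈∖⁻ A B j∈
    in j , j∈B , j∉A , rest
    where
    terms : map (λ j → p (A ∪ ⁅ j ⁆) ⊙ q (B - j)) (A ∖ B) ≡ map (λ j → p (A ⊞ j) ⊙ q (B ⊟ j)) (A ∖ B)
    terms = map-cong (λ j → cong₂ (λ S T → p S ⊙ q T) (∪⁅⁆≡⊞ A j) (-≡⊟ B j)) (A ∖ B)

  Rel⇒IP : ∀ {m r s} (p q : Vect m) →
           (∀ A B → suc ∣ A ∣ ≡ r → ∣ B ∣ ≡ suc s → Rel p q A B) → IP r s p q
  Rel⇒IP p q rel A B ∣A∣ ∣B∣ = ⇒MinTwice _ (A ∖ B) λ {i} i∈ fin →
    let i∈B , i∉A = ∈∖⁻ A B i∈
        j , j∈B , j∉A , j≢i , le = rel A B ∣A∣ ∣B∣ i∈B i∉A (fin ∘ trans (term i))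
    in j , ∈∖⁺ A B j∈B j∉A , j≢i , subst₂ _≤𝕋_ (sym (term j)) (sym (term i)) le
    where
    term : ∀ j → p (A ∪ ⁅ j ⁆) ⊙ q (B - j) ≡ p (A ⊞ j) ⊙ q (B ⊟ j)
    term j = cong₂ (λ S T → p S ⊙ q T) (∪⁅⁆≡⊞ A j) (-≡⊟ B j)

  -- B ∖ A has two elements, and exchanging them swaps the two factors.
  ⊆⇒Rel : ∀ {m} (p : Vect m) A B → A ⊆ B → ∣ B ∣ ≡ suc (suc ∣ A ∣) → Rel p p A B
  ⊆⇒Rel p A B A⊆B ∣B∣ {i} i∈B i∉A fin =
    let j , j∈B , j∉A⊞i = ∣∣<⇒∃∉ (A ⊞ i) B (subst₂ _<_ (sym (∣⊞∣ i∉A)) (sym ∣B∣) (ℕₚ.n<1+n _))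
        j≢i , j∉A = ∉⊞⁻ j∉A⊞i
    in j , j∈B , j∉A , j≢i ,
       ≤𝕋-reflexive (trans (⊙-comm (p (A ⊞ j)) (p (B ⊟ j)))
         (cong₂ (λ S T → p S ⊙ p T) (B⊟≡ j∈B i∈B j∉A i∉A (j≢i ∘ sym)) (sym (B⊟≡ i∈B j∈B i∉A j∉A j≢i))))
    where
    B⊟≡ : ∀ {x y} → x ∈ B → y ∈ B → x ∉ A → y ∉ A → y ≢ x → B ⊟ x ≡ A ⊞ y
    B⊟≡ {x} {y} x∈B y∈B x∉A y∉A y≢x = sym (⊆∧∣∣≡⇒≡ sub card)
      where
      sub : A ⊞ y ⊆ B ⊟ x
      sub = ⊞-⊆ (λ w∈A → ∈⊟⁺ (A⊆B w∈A) (∈⇒≢ w∈A x∉A)) (∈⊟⁺ y∈B y≢x)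
      card : ∣ A ⊞ y ∣ ≡ ∣ B ⊟ x ∣
      card = trans (∣⊞∣ y∉A) (ℕₚ.suc-injective (trans (sym ∣B∣) (sym (∣⊟∣ x∈B))))

  module _ {m} (p : Vect m) (I J : Subset m) {i : Fin m} (i∈I : i ∈ I) (i∉J : i ∉ J) where
    private
      I⁻ = I ⊟ i
      J⁺ = J ⊞ i
      g = λ j → p (I⁻ ⊞ j) ⊙ p (J⁺ ⊟ j)

    GP-list : List 𝕋
    GP-list = p I ⊙ p J ∷ map (λ j → p ((I - i) ∪ ⁅ j ⁆) ⊙ p ((J - j) ∪ ⁅ i ⁆)) (I ∖ J)

    -- For `I⁻` and `J⁺` the index set is J ∖ I together with `i`, and the leading entry `p I ⊙ p J`
    -- is the term at `i`.
    GP-list≡ : GP-list ≡ map g (i ∷ I ∖ J)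
    GP-list≡ = cong₂ _∷_ (cong₂ (λ S T → p S ⊙ p T) (sym (⊟-⊞ i∈I)) (sym (⊞-⊟ i∉J)))
      (map-cong-local (All.tabulate λ {j} j∈ → let j∈J , j∉I = ∈∖⁻ I J j∈ in
         cong₂ (λ S T → p S ⊙ p T)
           (trans (∪⁅⁆≡⊞ (I - i) j) (cong (_⊞ j) (-≡⊟ I i)))
           (trans (∪⁅⁆≡⊞ (J - j) i) (trans (cong (_⊞ i) (-≡⊟ J j)) ([]≔-commutes J j i (∈⇒≢ j∈J i∉J))))))

    i∷∖-unique : Unique (i ∷ I ∖ J)
    i∷∖-unique = All.tabulate (λ j∈ eq → proj₂ (∈∖⁻ I J j∈) (subst (_∈ I) eq i∈I)) ∷ ∖-unique I J

    ∈i∷∖⁺ : ∀ {j} → j ∈ J⁺ → j ∉ I⁻ → j ∈ˡ i ∷ I ∖ J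
    ∈i∷∖⁺ {j} j∈B j∉A with j ≟ i
    ... | yes j≡i = here j≡i
    ... | no  j≢i = there (∈∖⁺ I J (∈⊞⁻ j∈B j≢i) (∉⊟⁻ j∉A j≢i))

    ∈i∷∖⁻ : ∀ {j} → j ∈ˡ i ∷ I ∖ J → j ∈ J⁺ × j ∉ I⁻
    ∈i∷∖⁻ (here refl) = j∈S⊞j J i , j∉S⊟j I i
    ∈i∷∖⁻ (there j∈)  with j∈J , j∉I ← ∈∖⁻ I J j∈ = ∈⊞⁺ i j∈J , ∉⊟⁺ i j∉I

    Rel⇒GP-list : Rel p p I⁻ J⁺ → MinTwice GP-list
    Rel⇒GP-list rel = subst MinTwice (sym GP-list≡) (⇒MinTwice g (i ∷ I ∖ J) λ k∈ fin →
      let k∈B , k∉A = ∈i∷∖⁻ k∈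
          j , j∈B , j∉A , rest = rel k∈B k∉A fin
      in j , ∈i∷∖⁺ j∈B j∉A , rest)

    GP-list⇒Rel : MinTwice GP-list → Rel p p I⁻ J⁺
    GP-list⇒Rel mt k∈B k∉A fin =
      let j , j∈ , rest = MinTwice⇒ g _≟_ i∷∖-unique (subst MinTwice GP-list≡ mt) (∈i∷∖⁺ k∈B k∉A) fin
          j∈B , j∉A = ∈i∷∖⁻ j∈
      in j , j∈B , j∉A , rest

  Rel⇒GP : ∀ {m k} {p : Vect m} →
           (∀ A B → suc ∣ A ∣ ≡ k → ∣ B ∣ ≡ suc k → Rel p p A B) → GP k p
  Rel⇒GP {p = p} rel I J ∣I∣ ∣J∣ _ i i∈I i∉J = Rel⇒GP-list p I J i∈I i∉J
    (rel (I ⊟ i) (J ⊞ i) (trans (∣⊟∣ i∈I) ∣I∣) (trans (∣⊞∣ i∉J) (cong suc ∣J∣)))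

  -- If A is not contained in B, then I ∩ J is a proper subset of A for I = A + i and J = B - i, so
  -- `GP` has a relation for this pair. If A ⊆ B, only two terms occur and they are equal.
  GP⇒Rel : ∀ {m k} {p : Vect m} → GP k p →
           ∀ A B → suc ∣ A ∣ ≡ k → ∣ B ∣ ≡ suc k → Rel p p A B
  GP⇒Rel {k = k} {p} gp A B ∣A∣ ∣B∣ {i} i∈B i∉A with ⊆⊎∃∉ A B
  ... | inj₁ A⊆B = ⊆⇒Rel p A B A⊆B (trans ∣B∣ (cong suc (sym ∣A∣))) i∈B i∉A
  ... | inj₂ (x , x∈A , x∉B) =
    subst₂ (λ S T → Rel p p S T) (⊞-⊟ i∉A) (⊟-⊞ i∈B)
      (GP-list⇒Rel p I J (j∈S⊞j A i) (j∉S⊟j B i) (gp I J ∣I∣ ∣J∣ small i (j∈S⊞j A i) (j∉S⊟j B i))) i∈B i∉A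
    where
    I = A ⊞ i
    J = B ⊟ i
    ∣I∣ = trans (∣⊞∣ i∉A) ∣A∣
    ∣J∣ = ℕₚ.suc-injective (trans (∣⊟∣ i∈B) ∣B∣)
    sub : I ∩ J ⊂ A
    sub = (λ w∈ → let w∈I , w∈J = x∈p∩q⁻ I J w∈ in ∈⊞⁻ w∈I (∈⇒≢ w∈J (j∉S⊟j B i))) ,
          x , x∈A , λ x∈ → x∉B (∈⊟⁻ B i (proj₂ (x∈p∩q⁻ I J x∈)))
    small : suc ∣ I ∩ J ∣ < k
    small = subst (suc ∣ I ∩ J ∣ <_) ∣A∣ (s≤s (p⊂q⇒∣p∣<∣q∣ sub))

  -- Three-term relations from the relations with `z` outside B ∖ A.

  module Extension {m r : ℕ} (z : Fin m) (u : Vect m)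
    (known : ∀ A B → ∣ A ∣ ≡ r → ∣ B ∣ ≡ suc (suc r) → z ∈ A ⊎ z ∉ B → Rel u u A B) where

    -- The terms belong to the three splittings of {a, b, c, d} into pairs; the one for ab|cd, if
    -- finite, must not be the strict minimum.
    ThreeTerm : Subset m → (a b c d : Fin m) → Set
    ThreeTerm X a b c d =
      u (X ⊞ a ⊞ b) ⊙ u (X ⊞ c ⊞ d) ≢ ∞ →
      u (X ⊞ a ⊞ c) ⊙ u (X ⊞ b ⊞ d) ≤𝕋 u (X ⊞ a ⊞ b) ⊙ u (X ⊞ c ⊞ d) ⊎
      u (X ⊞ a ⊞ d) ⊙ u (X ⊞ b ⊞ c) ≤𝕋 u (X ⊞ a ⊞ b) ⊙ u (X ⊞ c ⊞ d)

    private module Local (X : Subset m) where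

      u₂-comm : ∀ a b → u (X ⊞ a ⊞ b) ≡ u (X ⊞ b ⊞ a)
      u₂-comm a b with a ≟ b
      ... | yes refl = refl
      ... | no  a≢b  = cong u ([]≔-commutes X a b a≢b)

      transport : ∀ {x y v x′ y′ v′} → x ≡ x′ → y ≡ y′ → v ≡ v′ →
        (v ≢ ∞ → x ≤𝕋 v ⊎ y ≤𝕋 v) → v′ ≢ ∞ → x′ ≤𝕋 v′ ⊎ y′ ≤𝕋 v′
      transport refl refl refl h = h

    -- The relation for X + a and X + b + c + d, whose only indices are b, c and d, used at b.
    threeTerm-known : ∀ {X a b c d} → suc ∣ X ∣ ≡ r →
      All (_∉ X) (a ∷ b ∷ c ∷ d ∷ []) → Unique (a ∷ b ∷ c ∷ d ∷ []) →
      z ∈ X ⊞ a ⊎ z ∉ X ⊞ b ⊞ c ⊞ d → ThreeTerm X a b c d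
    threeTerm-known {X} {a} {b} {c} {d} ∣X∣
      (a∉X ∷ b∉X ∷ c∉X ∷ d∉X ∷ []) ((a≢b ∷ a≢c ∷ a≢d ∷ []) ∷ (b≢c ∷ b≢d ∷ []) ∷ (c≢d ∷ []) ∷ [] ∷ [])
      z? fin = answer (known (X ⊞ a) Y (trans (∣⊞∣ a∉X) ∣X∣) ∣Y∣ z? b∈Y b∉Xa
        (subst (λ S → u (X ⊞ a ⊞ b) ⊙ u S ≢ ∞) (sym Y⊟b) fin))
      where
      Y = X ⊞ b ⊞ c ⊞ d
      ∣Y∣ : ∣ Y ∣ ≡ suc (suc r)
      ∣Y∣ = trans (∣⊞∣ (∉⊞⁺ (∉⊞⁺ d∉X (b≢d ∘ sym)) (c≢d ∘ sym)))
              (cong suc (trans (∣⊞∣ (∉⊞⁺ c∉X (b≢c ∘ sym))) (cong suc (trans (∣⊞∣ b∉X) ∣X∣))))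
      b∈Y : b ∈ Y
      b∈Y = ∈⊞⁺ d (∈⊞⁺ c (j∈S⊞j X b))
      b∉Xa : b ∉ X ⊞ a
      b∉Xa = ∉⊞⁺ b∉X (a≢b ∘ sym)
      Y⊟d : Y ⊟ d ≡ X ⊞ b ⊞ c
      Y⊟d = ⊞-⊟ (∉⊞⁺ (∉⊞⁺ d∉X (b≢d ∘ sym)) (c≢d ∘ sym))
      Y⊟c : Y ⊟ c ≡ X ⊞ b ⊞ d
      Y⊟c = trans ([]≔-commutes _ d c (c≢d ∘ sym)) (cong (_⊞ d) (⊞-⊟ (∉⊞⁺ c∉X (b≢c ∘ sym))))
      Y⊟b : Y ⊟ b ≡ X ⊞ c ⊞ d
      Y⊟b = trans ([]≔-commutes _ d b (b≢d ∘ sym))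
              (cong (_⊞ d) (trans ([]≔-commutes _ c b (b≢c ∘ sym)) (cong (_⊞ c) (⊞-⊟ b∉X))))
      answer : (∃ λ j → j ∈ Y × j ∉ X ⊞ a × j ≢ b ×
                 u (X ⊞ a ⊞ j) ⊙ u (Y ⊟ j) ≤𝕋 u (X ⊞ a ⊞ b) ⊙ u (Y ⊟ b)) → _
      answer (j , j∈Y , j∉Xa , j≢b , le) with j ≟ c | j ≟ d
      ... | yes refl | _ = inj₁ (subst₂ (λ S T → u (X ⊞ a ⊞ c) ⊙ u S ≤𝕋 u (X ⊞ a ⊞ b) ⊙ u T) Y⊟c Y⊟b le)
      ... | no _ | yes refl = inj₂ (subst₂ (λ S T → u (X ⊞ a ⊞ d) ⊙ u S ≤𝕋 u (X ⊞ a ⊞ b) ⊙ u T) Y⊟d Y⊟b le)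
      ... | no j≢c | no j≢d =
        contradiction (∈⊞⁻ (∈⊞⁻ (∈⊞⁻ j∈Y j≢d) j≢c) j≢b) (proj₂ (∉⊞⁻ j∉Xa))

    -- If `z` is b, c or d, a renaming that fixes the splitting ab|cd moves `z` to the first place,
    -- where the relation is known; the other two splittings may change places. The last case
    -- includes z = a.
    threeTerm : ∀ {X a b c d} → suc ∣ X ∣ ≡ r →
      All (_∉ X) (a ∷ b ∷ c ∷ d ∷ []) → Unique (a ∷ b ∷ c ∷ d ∷ []) → ThreeTerm X a b c d
    threeTerm {X} {a} {b} {c} {d} ∣X∣ out@(a∉ ∷ b∉ ∷ c∉ ∷ d∉ ∷ [])
      un@((a≢b ∷ a≢c ∷ a≢d ∷ []) ∷ (b≢c ∷ b≢d ∷ []) ∷ (c≢d ∷ []) ∷ [] ∷ [])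
      with z ≟ b | z ≟ c | z ≟ d | z ∈? X
    ... | yes refl | _ | _ | _ =
      swap ∘ transport (⊙-comm _ _) (⊙-comm _ _) (cong₂ _⊙_ (u₂-comm b a) refl)
        (threeTerm-known ∣X∣ (b∉ ∷ a∉ ∷ c∉ ∷ d∉ ∷ [])
          ((≢-sym a≢b ∷ b≢c ∷ b≢d ∷ []) ∷ (a≢c ∷ a≢d ∷ []) ∷ (c≢d ∷ []) ∷ [] ∷ []) (inj₁ (j∈S⊞j X z)))
      where open Local X
    ... | no _ | yes refl | _ | _ =
      transport (cong₂ _⊙_ (u₂-comm c a) (u₂-comm d b))
        (trans (cong₂ _⊙_ (u₂-comm c b) (u₂-comm d a)) (⊙-comm _ _)) (⊙-comm _ _)
        (threeTerm-known ∣X∣ (c∉ ∷ d∉ ∷ a∉ ∷ b∉ ∷ [])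
          ((c≢d ∷ ≢-sym a≢c ∷ ≢-sym b≢c ∷ []) ∷ (≢-sym a≢d ∷ ≢-sym b≢d ∷ []) ∷ (a≢b ∷ []) ∷ [] ∷ [])
          (inj₁ (j∈S⊞j X z)))
      where open Local X
    ... | no _ | no _ | yes refl | _ =
      swap ∘ transport (cong₂ _⊙_ (u₂-comm d a) (u₂-comm c b))
        (trans (cong₂ _⊙_ (u₂-comm d b) (u₂-comm c a)) (⊙-comm _ _))
        (trans (cong₂ _⊙_ (u₂-comm d c) refl) (⊙-comm _ _))
        (threeTerm-known ∣X∣ (d∉ ∷ c∉ ∷ a∉ ∷ b∉ ∷ [])
          ((≢-sym c≢d ∷ ≢-sym a≢d ∷ ≢-sym b≢d ∷ []) ∷ (≢-sym a≢c ∷ ≢-sym b≢c ∷ []) ∷ (a≢b ∷ []) ∷ [] ∷ [])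
          (inj₁ (j∈S⊞j X z)))
      where open Local X
    ... | no _ | no _ | no _ | yes z∈X = threeTerm-known ∣X∣ out un (inj₁ (∈⊞⁺ a z∈X))
    ... | no z≢b | no z≢c | no z≢d | no z∉X =
      threeTerm-known ∣X∣ out un (inj₂ (∉⊞⁺ (∉⊞⁺ (∉⊞⁺ z∉X z≢b) z≢c) z≢d))

    -- Basis exchange for the sets on which `u` is finite.

    Finite : Subset m → Set
    Finite S = u S ≢ ∞

    -- A term that is at most a finite one is finite, so a known relation gives an exchange of
    -- finite sets.
    exchange : ∀ {A B i} → ∣ A ∣ ≡ r → ∣ B ∣ ≡ suc (suc r) → z ∈ A ⊎ z ∉ B →
      i ∈ B → i ∉ A → Finite (A ⊞ i) → Finite (B ⊟ i) →
      ∃ λ j → j ∈ B × j ∉ A × j ≢ i × Finite (A ⊞ j) × Finite (B ⊟ j)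
    exchange {A} {B} {i} ∣A∣ ∣B∣ z? i∈B i∉A fA fB =
      let j , j∈B , j∉A , j≢i , le = known A B ∣A∣ ∣B∣ z? i∈B i∉A (⊙-finite⁺ fA fB)
      in j , j∈B , j∉A , j≢i , ⊙-finite⁻ (≤𝕋-finite le (⊙-finite⁺ fA fB))

    -- This is exchange for (L - z, K + z) at z, which is not among the known pairs. For v in L - z
    -- outside K, the pair (L - v, K + v) is known, since z lies in L - v; it replaces K by K - j +
    -- v, which is closer to L. Once L - z ⊆ K, adding the missing element gives K itself.
    augment : ∀ {K L} → ∣ K ∣ ≡ suc r → ∣ L ∣ ≡ suc r → z ∉ K → z ∈ L → Finite K → Finite L →
      Acc _⊂_ (L ─ K) → ∃ λ j → j ∈ K × j ∉ L × Finite (L ⊟ z ⊞ j)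
    augment {K} {L} ∣K∣ ∣L∣ z∉K z∈L fK fL (acc rs) with ⊆⊎∃∉ (L ⊟ z) K
    ... | inj₁ L⊟z⊆K =
      let j , j∈K , j∉L⊟z = ∣∣<⇒∃∉ (L ⊟ z) K (ℕₚ.≤-reflexive (trans (∣⊟∣ z∈L) (trans ∣L∣ (sym ∣K∣))))
      in j , j∈K , ∉⊟⁻ j∉L⊟z (∈⇒≢ j∈K z∉K) ,
         subst Finite (sym (⊆∧∣∣≡⇒≡ (⊞-⊆ L⊟z⊆K j∈K)
           (trans (∣⊞∣ j∉L⊟z) (trans (∣⊟∣ z∈L) (trans ∣L∣ (sym ∣K∣)))))) fK
    ... | inj₂ (v , v∈L⊟z , v∉K) =
      let v∈L = ∈⊟⁻ L z v∈L⊟z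
          v≢z = ∈⇒≢ v∈L⊟z (j∉S⊟j L z)
          j , j∈K⊞v , j∉L⊟v , j≢v , _ , fK⊞v⊟j =
            exchange (ℕₚ.suc-injective (trans (∣⊟∣ v∈L) ∣L∣)) (trans (∣⊞∣ v∉K) (cong suc ∣K∣))
              (inj₁ (∈⊟⁺ z∈L (≢-sym v≢z))) (j∈S⊞j K v) (j∉S⊟j L v)
              (subst Finite (sym (⊟-⊞ v∈L)) fL) (subst Finite (sym (⊞-⊟ v∉K)) fK)
          j∈K = ∈⊞⁻ j∈K⊞v j≢v
          j∉L = ∉⊟⁻ j∉L⊟v j≢v
          i , i∈K′ , i∉L , fin = augment {K ⊟ j ⊞ v} (trans (∣⊟⊞∣ j∈K v∉K) ∣K∣) ∣L∣
            (∉⊞⁺ (∉⊟⁺ j z∉K) (≢-sym v≢z)) z∈L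
            (subst Finite ([]≔-commutes K v j (≢-sym j≢v)) fK⊞v⊟j) fL (rs (─-⊂ v∈L v∉K j∉L))
      in i , ∈⊟⁻ K j (∈⊞⁻ i∈K′ (≢-sym (∈⇒≢ v∈L i∉L))) , i∉L , fin

    -- Guarantees that some `i` admits a finite u(B′ - e), so that the minimal choice of v exists
    -- and the value can be cancelled.
    approach : ∀ {A B e} → ∣ A ∣ ≡ r → ∣ B ∣ ≡ suc (suc r) → z ∉ A → z ∈ B → e ∈ B → e ∉ A →
      Finite (A ⊞ e) → Finite (B ⊟ e) → ∀ {x} → x ∈ A → x ∉ B →
      ∃ λ i → i ∈ A × i ∉ B × ∃ λ j → j ∈ B × j ∉ A × j ≢ e × Finite (B ⊟ e ⊟ j ⊞ i)
    approach {A} {B} {e} ∣A∣ ∣B∣ z∉A z∈B e∈B e∉A fA fB {x} x∈A x∉B with e ≟ z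
    ... | yes refl =
      -- Moving z = e into the first set and x into the second makes the pair known; x then serves
      -- as `i`.
      let j , j∈ , j∉ , j≢x , _ , fin =
            exchange {A ⊟ x ⊞ z} {B ⊟ z ⊞ x} (trans (∣⊟⊞∣ x∈A z∉A) ∣A∣) (trans (∣⊟⊞∣ z∈B x∉B) ∣B∣)
              (inj₁ (j∈S⊞j (A ⊟ x) z)) (j∈S⊞j (B ⊟ z) x)
              (∉⊞⁺ (j∉S⊟j A x) (∈⇒≢ x∈A z∉A))
              (subst Finite (sym (trans ([]≔-commutes (A ⊟ x) z x (≢-sym (∈⇒≢ x∈A z∉A))) (cong (_⊞ z) (⊟-⊞ x∈A)))) fA)
              (subst Finite (sym (⊞-⊟ (∉⊟⁺ z x∉B))) fB)
          j≢z , j∉A⊟x = ∉⊞⁻ j∉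
      in x , x∈A , x∉B , j , ∈⊟⁻ B z (∈⊞⁻ j∈ j≢x) , ∉⊟⁻ j∉A⊟x j≢x , j≢z ,
         subst Finite ([]≔-commutes (B ⊟ z) x j (≢-sym j≢x)) fin
    ... | no e≢z = first (augment ∣A⊞e∣ ∣L∣ (∉⊞⁺ z∉A z≢e) z∈L fA fB (⊂-wellFounded _))
      where
      z≢e = ≢-sym e≢z
      L = B ⊟ e
      z∈L : z ∈ L
      z∈L = ∈⊟⁺ z∈B z≢e
      ∣A⊞e∣ : ∣ A ⊞ e ∣ ≡ suc r
      ∣A⊞e∣ = trans (∣⊞∣ e∉A) (cong suc ∣A∣)
      ∣L∣ : ∣ L ∣ ≡ suc r
      ∣L∣ = ℕₚ.suc-injective (trans (∣⊟∣ e∈B) ∣B∣)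
      ∣L⊟∣ : ∀ {v} → v ∈ L → ∣ L ⊟ v ∣ ≡ r
      ∣L⊟∣ v∈L = ℕₚ.suc-injective (trans (∣⊟∣ v∈L) ∣L∣)
      Goal = ∃ λ i → i ∈ A × i ∉ B × ∃ λ j → j ∈ B × j ∉ A × j ≢ e × Finite (L ⊟ j ⊞ i)

      via-z : ∀ {j} → j ∈ A → j ∉ L → Finite (L ⊟ z ⊞ j) → Goal
      via-z j∈A j∉L fin = _ , j∈A , ∉⊟⁻ j∉L (∈⇒≢ j∈A e∉A) , z , z∈B , z∉A , z≢e , fin

      -- Here `augment` returned e, which is not in A. Exchanging some v of L outside A yields an
      -- element of A or again e; in the latter case A + v is finite, and exchange for (L - z, A + v
      -- + e), which avoids z, replaces e by an element of A.
      second : Finite (L ⊟ z ⊞ e) → ∀ {v} → v ∈ L → v ≢ z → v ∉ A → Goal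
      second fin {v} v∈L v≢z v∉A
        with exchange {L ⊟ v} {A ⊞ e ⊞ v} (∣L⊟∣ v∈L) (trans (∣⊞∣ v∉A⊞e) (cong suc ∣A⊞e∣))
               (inj₁ (∈⊟⁺ z∈L (≢-sym v≢z))) (j∈S⊞j (A ⊞ e) v) (j∉S⊟j L v)
               (subst Finite (sym (⊟-⊞ v∈L)) fB) (subst Finite (sym (⊞-⊟ v∉A⊞e)) fA)
        where
        v≢e = ∈⇒≢ v∈L (j∉S⊟j B e)
        v∉A⊞e = ∉⊞⁺ v∉A v≢e
      ... | j , j∈ , j∉L⊟v , j≢v , fL⊟v⊞j , fin′ with j ≟ e
      ... | no j≢e =
        let j∈A = ∈⊞⁻ (∈⊞⁻ j∈ j≢v) j≢e
        in j , j∈A , ∉⊟⁻ (∉⊟⁻ j∉L⊟v j≢v) j≢e , v , ∈⊟⁻ B e v∈L , v∉A , ∈⇒≢ v∈L (j∉S⊟j B e) , fL⊟v⊞j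
      ... | yes refl =
        let e∉A⊞v = ∉⊞⁺ e∉A j≢v
            i , i∈ , i∉L⊟z , i≢e , fL⊟z⊞i , _ =
              exchange {L ⊟ z} {A ⊞ v ⊞ e} (∣L⊟∣ z∈L)
                (trans (∣⊞∣ e∉A⊞v) (cong suc (trans (∣⊞∣ v∉A) (cong suc ∣A∣))))
                (inj₂ (∉⊞⁺ (∉⊞⁺ z∉A (≢-sym v≢z)) z≢e)) (j∈S⊞j (A ⊞ v) e) (∉⊟⁺ z (j∉S⊟j B e)) fin
                (subst (λ S → Finite (S ⊟ e)) ([]≔-commutes A e v j≢v) fin′)
            i∈A = ∈⊞⁻ (∈⊞⁻ i∈ i≢e) (≢-sym (∈⇒≢ (∈⊟⁺ v∈L v≢z) i∉L⊟z))
        in via-z i∈A (∉⊟⁻ i∉L⊟z (∈⇒≢ i∈A z∉A)) fL⊟z⊞i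

      first : (∃ λ j → j ∈ A ⊞ e × j ∉ L × Finite (L ⊟ z ⊞ j)) → Goal
      first (j , j∈ , j∉L , fin) with j ≟ e
      ... | no  j≢e  = via-z (∈⊞⁻ j∈ j≢e) j∉L fin
      ... | yes refl =
        -- L - z has r elements and A - x only r - 1; as x is not in B, the v found is outside all
        -- of A.
        let v , v∈ , v∉A⊟x = ∣∣<⇒∃∉ (A ⊟ x) (L ⊟ z)
              (ℕₚ.≤-reflexive (trans (∣⊟∣ x∈A) (trans ∣A∣ (sym (∣L⊟∣ z∈L)))))
            v∈L = ∈⊟⁻ L z v∈
        in second fin v∈L (∈⇒≢ v∈ (j∉S⊟j L z)) (∉⊟⁻ v∉A⊟x (∈⇒≢ (∈⊟⁻ B e v∈L) x∉B))

    -- The minimal exchange and the induction on A ∖ B.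

    module _ {A B : Subset m} {e i : Fin m} where
      private
        L = B ⊟ e
        f = λ v → u (A ⊞ v) ⊙ u (L ⊟ v ⊞ i)
        -- Only the second factor of `f v` must be finite, since it is cancelled later; u(A + v) may
        -- be infinite.
        Candidate = λ v → v ∈ B × v ∉ A × v ≢ e × Finite (L ⊟ v ⊞ i)

        candidate? : ∀ v → Dec (Candidate v)
        candidate? v = (v ∈? B) ×-dec ¬? (v ∈? A) ×-dec ¬? (v ≟ e) ×-dec ¬? (∞? (u (L ⊟ v ⊞ i)))

      -- Minimality over the candidates extends to every other w, because `f w` is then infinite.
      best : ∀ {c} → Candidate c → ∃ λ v → Candidate v × ∀ {w} → w ∈ B → w ∉ A → w ≢ e → f v ≤𝕋 f w
      best cand =
        let v , v∈ , min = argmin f (filter candidate? (allFin m)) (∈-filter⁺ candidate? (∈-allFin _) cand)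
        in v , proj₂ (∈-filter⁻ candidate? {xs = allFin m} v∈) , λ {w} w∈B w∉A w≢e → minimal v min w∈B w∉A w≢e
        where
        minimal : ∀ v → (∀ {w} → w ∈ˡ filter candidate? (allFin m) → f v ≤𝕋 f w) →
                  ∀ {w} → w ∈ B → w ∉ A → w ≢ e → f v ≤𝕋 f w
        minimal v min {w} w∈B w∉A w≢e with ∞? (f w)
        ... | yes f≡∞ = subst (f v ≤𝕋_) (sym f≡∞) tt
        ... | no  f≢∞ = min (∈-filter⁺ candidate? (∈-allFin _) (w∈B , w∉A , w≢e , proj₂ (⊙-finite⁻ f≢∞)))

      -- The relation for B′ gives α j + t ≤ k + s. With X = B - e - v - j, the three-term relation
      -- bounds one of two products by l + t; adding these inequalities and cancelling s leaves a
      -- bound by k + l, the term at e.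
      step : ∣ B ∣ ≡ suc (suc r) → e ∈ B → e ∉ A → Finite (A ⊞ e) → i ∈ A → i ∉ B → Finite L →
        ∀ {v} → Candidate v → (∀ {w} → w ∈ B → w ∉ A → w ≢ e → f v ≤𝕋 f w) →
        Rel u u A (B ⊟ v ⊞ i) →
        ∃ λ j → j ∈ B × j ∉ A × j ≢ e × u (A ⊞ j) ⊙ u (B ⊟ j) ≤𝕋 u (A ⊞ e) ⊙ u L
      step ∣B∣ e∈B e∉A fA i∈A i∉B fL {v} (v∈B , v∉A , v≢e , fs) min rel
        with rel {e} (∈⊞⁺ i (∈⊟⁺ e∈B (≢-sym v≢e))) e∉A
               (⊙-finite⁺ fA (subst Finite (sym (⊟⊞⊟-commutes (∈⇒≢ i∈A e∉A) v≢e)) fs))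
      ... | j , j∈B′ , j∉A , j≢e , le = conclude (threeTerm ∣X∣ (j∉X ∷ v∉X ∷ e∉X ∷ i∉X ∷ [])
                 ((j≢v ∷ j≢e ∷ j≢i ∷ []) ∷ (v≢e ∷ v≢i ∷ []) ∷ (e≢i ∷ []) ∷ [] ∷ []) fin₃)
        where
        v≢i = ∈⇒≢ v∈B i∉B
        i≢e = ∈⇒≢ i∈A e∉A
        e≢i = ≢-sym i≢e
        j≢i = ≢-sym (∈⇒≢ i∈A j∉A)
        j∈B⊟v = ∈⊞⁻ j∈B′ j≢i
        j∈B = ∈⊟⁻ B v j∈B⊟v
        j≢v = ∈⇒≢ j∈B⊟v (j∉S⊟j B v)
        v∈L = ∈⊟⁺ v∈B v≢e
        j∈L⊟v = ∈⊟⁺ (∈⊟⁺ j∈B j≢e) j≢v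
        X = L ⊟ v ⊟ j
        j∉X = j∉S⊟j (L ⊟ v) j
        v∉X = ∉⊟⁺ j (j∉S⊟j L v)
        e∉X = ∉⊟⁺ j (∉⊟⁺ v (j∉S⊟j B e))
        i∉X = ∉⊟⁺ j (∉⊟⁺ v (∉⊟⁺ e i∉B))
        ∣X∣ : suc ∣ X ∣ ≡ r
        ∣X∣ = trans (∣⊟∣ j∈L⊟v) (ℕₚ.suc-injective (trans (∣⊟∣ v∈L) (ℕₚ.suc-injective (trans (∣⊟∣ e∈B) ∣B∣))))

        ⊟e⊟⊞e : ∀ {w} → w ≢ e → L ⊟ w ⊞ e ≡ B ⊟ w
        ⊟e⊟⊞e {w} w≢e = trans (cong (_⊞ e) ([]≔-commutes B e w (≢-sym w≢e))) (⊟-⊞ (∈⊟⁺ e∈B (≢-sym w≢e)))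

        X⊞j : X ⊞ j ≡ L ⊟ v
        X⊞j = ⊟-⊞ j∈L⊟v
        X⊞v : X ⊞ v ≡ L ⊟ j
        X⊞v = trans (cong (_⊞ v) ([]≔-commutes L v j (≢-sym j≢v))) (⊟-⊞ (∈⊟⁺ v∈L (≢-sym j≢v)))
        X⊞j⊞v : X ⊞ j ⊞ v ≡ L
        X⊞j⊞v = trans (cong (_⊞ v) X⊞j) (⊟-⊞ v∈L)
        X⊞e⊞i : X ⊞ e ⊞ i ≡ B ⊟ v ⊞ i ⊟ j
        X⊞e⊞i = trans (cong (_⊞ i) (trans ([]≔-commutes (L ⊟ v) j e j≢e) (cong (_⊟ j) (⊟e⊟⊞e v≢e))))
                  ([]≔-commutes (B ⊟ v) j i j≢i)
        k = u (A ⊞ e)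
        l = u L
        s = u (L ⊟ v ⊞ i)
        t = u (X ⊞ e ⊞ i)
        α = λ w → u (A ⊞ w)
        β = λ w → u (B ⊟ w)

        le′ : α j ⊙ t ≤𝕋 k ⊙ s
        le′ = subst₂ (λ S T → α j ⊙ u S ≤𝕋 k ⊙ u T) (sym X⊞e⊞i) (⊟⊞⊟-commutes i≢e v≢e) le

        fin₃ : u (X ⊞ j ⊞ v) ⊙ t ≢ ∞
        fin₃ = ⊙-finite⁺ (subst Finite (sym X⊞j⊞v) fL) (proj₂ (⊙-finite⁻ (≤𝕋-finite le′ (⊙-finite⁺ fA fs))))

        bound : α j ⊙ (l ⊙ t) ≤𝕋 s ⊙ (k ⊙ l)
        bound = subst₂ _≤𝕋_ (x∙yz≈y∙xz l (α j) t) (x∙yz≈z∙yx l k s) (⊙-monoʳ-≤ l le′)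

        conclude : u (X ⊞ j ⊞ e) ⊙ u (X ⊞ v ⊞ i) ≤𝕋 u (X ⊞ j ⊞ v) ⊙ t ⊎
                   u (X ⊞ j ⊞ i) ⊙ u (X ⊞ v ⊞ e) ≤𝕋 u (X ⊞ j ⊞ v) ⊙ t →
                   ∃ λ j → j ∈ B × j ∉ A × j ≢ e × α j ⊙ β j ≤𝕋 k ⊙ l
        -- The witness is v: s + α v + β v ≤ α j + t₂ + β v by minimality of v, then ≤ α j + l + t ≤
        -- s + k + l.
        conclude (inj₁ p) = v , v∈B , v∉A , v≢e , ⊙-cancelˡ-≤ s fs
          (≤𝕋-trans (s ⊙ (α v ⊙ β v)) (α j ⊙ (l ⊙ t)) (s ⊙ (k ⊙ l))
            (≤𝕋-trans (s ⊙ (α v ⊙ β v)) (β v ⊙ (α j ⊙ t₂)) (α j ⊙ (l ⊙ t))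
              (subst (_≤𝕋 β v ⊙ (α j ⊙ t₂)) (x∙yz≈z∙yx (β v) (α v) s) (⊙-monoʳ-≤ (β v) (min j∈B j∉A j≢e)))
              (subst (_≤𝕋 α j ⊙ (l ⊙ t)) (x∙yz≈y∙xz (α j) (β v) t₂) (⊙-monoʳ-≤ (α j) p′)))
            bound)
          where
          t₂ = u (L ⊟ j ⊞ i)
          p′ : β v ⊙ t₂ ≤𝕋 l ⊙ t
          p′ = subst₂ _≤𝕋_ (cong₂ (λ S T → u S ⊙ u T) (trans (cong (_⊞ e) X⊞j) (⊟e⊟⊞e v≢e)) (cong (_⊞ i) X⊞v))
                 (cong (λ S → u S ⊙ t) X⊞j⊞v) p
        -- The witness is j, without minimality: s + α j + β j ≤ α j + l + t ≤ s + k + l.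
        conclude (inj₂ p) = j , j∈B , j∉A , j≢e , ⊙-cancelˡ-≤ s fs
          (≤𝕋-trans (s ⊙ (α j ⊙ β j)) (α j ⊙ (l ⊙ t)) (s ⊙ (k ⊙ l))
            (subst (_≤𝕋 α j ⊙ (l ⊙ t)) (x∙yz≈y∙xz (α j) s (β j)) (⊙-monoʳ-≤ (α j) p′))
            bound)
          where
          p′ : s ⊙ β j ≤𝕋 l ⊙ t
          p′ = subst₂ _≤𝕋_ (cong₂ (λ S T → u S ⊙ u T) (cong (_⊞ i) X⊞j) (trans (cong (_⊞ e) X⊞v) (⊟e⊟⊞e j≢e)))
                 (cong (λ S → u S ⊙ t) X⊞j⊞v) p

    relation : ∀ {A B} → ∣ A ∣ ≡ r → ∣ B ∣ ≡ suc (suc r) → z ∉ A → z ∈ B → Acc _⊂_ (A ─ B) → Rel u u A B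
    relation {A} {B} ∣A∣ ∣B∣ z∉A z∈B (acc rs) {e} e∈B e∉A fin with ⊆⊎∃∉ A B
    ... | inj₁ A⊆B = ⊆⇒Rel u A B A⊆B (trans ∣B∣ (cong (λ k → suc (suc k)) (sym ∣A∣))) e∈B e∉A fin
    ... | inj₂ (x , x∈A , x∉B) =
      let fA , fB = ⊙-finite⁻ fin
          i , i∈A , i∉B , c , c∈B , c∉A , c≢e , fc = approach ∣A∣ ∣B∣ z∉A z∈B e∈B e∉A fA fB x∈A x∉B
          v , cand@(v∈B , v∉A , v≢e , _) , min = best {A} {B} {e} {i} (c∈B , c∉A , c≢e , fc)
      in step ∣B∣ e∈B e∉A fA i∈A i∉B fB cand min (closer v∈B v∉A i∈A i∉B)
      where
      closer : ∀ {v i} → v ∈ B → v ∉ A → i ∈ A → i ∉ B → Rel u u A (B ⊟ v ⊞ i)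
      closer {v} {i} v∈B v∉A i∈A i∉B with z ∈? B ⊟ v ⊞ i
      -- The exchanged v may be `z` itself; then B′ avoids `z` and its relation is known.
      ... | yes z∈ = relation ∣A∣ (trans (∣⊟⊞∣ v∈B i∉B) ∣B∣) z∉A z∈ (rs (─-⊂ i∈A i∉B v∉A))
      ... | no  z∉ = known A (B ⊟ v ⊞ i) ∣A∣ (trans (∣⊟⊞∣ v∈B i∉B) ∣B∣) (inj₂ z∉)

    all-relations : ∀ A B → ∣ A ∣ ≡ r → ∣ B ∣ ≡ suc (suc r) → Rel u u A B
    all-relations A B ∣A∣ ∣B∣ with z ∈? A | z ∈? B
    ... | yes z∈A | _       = known A B ∣A∣ ∣B∣ (inj₁ z∈A)
    ... | no _    | no z∉B  = known A B ∣A∣ ∣B∣ (inj₂ z∉B)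
    ... | no z∉A  | yes z∈B = relation ∣A∣ ∣B∣ z∉A z∈B (⊂-wellFounded _)

  -- Passing between relations on {0,...,n} and on [n], and rescaling.

  -- Since 0 is not in (b ∷ B) ∖ (a ∷ A), both relations range over the same indices.
  Rel-restrict : ∀ {n} (u : Vect (suc n)) {a b A B} → zero ∈ a ∷ A ⊎ zero ∉ b ∷ B →
    Rel u u (a ∷ A) (b ∷ B) → Rel (λ S → u (a ∷ S)) (λ S → u (b ∷ S)) A B
  Rel-restrict u {a} {b} {A} {B} 0? rel {i} i∈B i∉A fin = unsuc (rel (there i∈B) (i∉A ∘ drop-there) fin)
    where
    unsuc : (∃ λ j → j ∈ b ∷ B × j ∉ a ∷ A × j ≢ suc i × _) → _
    unsuc (zero  , 0∈ , 0∉ , _)       = contradiction 0? [ 0∉ , (λ 0∉B → 0∉B 0∈) ]′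
    unsuc (suc j , j∈ , j∉ , j≢ , le) = j , drop-there j∈ , j∉ ∘ there , j≢ ∘ cong suc , le

  Rel-extend : ∀ {n} (u : Vect (suc n)) {a b A B} → zero ∈ a ∷ A ⊎ zero ∉ b ∷ B →
    Rel (λ S → u (a ∷ S)) (λ S → u (b ∷ S)) A B → Rel u u (a ∷ A) (b ∷ B)
  Rel-extend u (inj₁ 0∈) rel {zero}  i∈ i∉ fin = contradiction 0∈ i∉
  Rel-extend u (inj₂ 0∉) rel {zero}  i∈ i∉ fin = contradiction i∈ 0∉
  Rel-extend u 0?        rel {suc i} i∈ i∉ fin =
    let j , j∈ , j∉ , j≢ , le = rel (drop-there i∈) (i∉ ∘ there) fin
    in suc j , there j∈ , j∉ ∘ drop-there , j≢ ∘ suc-injective , le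

  Rel-scale : ∀ {m} {p q p′ q′ : Vect m} {A B} a b →
    (∀ S → p′ S ≡ just a ⊙ p S) → (∀ S → q′ S ≡ just b ⊙ q S) → Rel p q A B → Rel p′ q′ A B
  Rel-scale {p = p} {q} {p′} {q′} {A} {B} a b p′≡ q′≡ rel {i} i∈B i∉A fin =
    let j , j∈B , j∉A , j≢i , le = rel i∈B i∉A (proj₂ (⊙-finite⁻ (fin ∘ trans (term i))))
    in j , j∈B , j∉A , j≢i ,
       subst₂ _≤𝕋_ (sym (term j)) (sym (term i))
         (⊙-monoʳ-≤ (just (a + b)) {p (A ⊞ j) ⊙ q (B ⊟ j)} {p (A ⊞ i) ⊙ q (B ⊟ i)} le)
    where
    term : ∀ j → p′ (A ⊞ j) ⊙ q′ (B ⊟ j) ≡ just (a + b) ⊙ (p (A ⊞ j) ⊙ q (B ⊟ j))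
    term j = trans (cong₂ _⊙_ (p′≡ (A ⊞ j)) (q′≡ (B ⊟ j))) (interchange (just a) (p (A ⊞ j)) (just b) (q (B ⊟ j)))

  ⊕-identityʳ : ∀ x → x ⊕ ∞ ≡ x
  ⊕-identityʳ nothing  = refl
  ⊕-identityʳ (just x) = refl

  ⊙-cancelʳ : ∀ {x y} w → w ≢ ∞ → just x ⊙ w ≡ just y ⊙ w → x ≡ y
  ⊙-cancelʳ nothing  w≢∞ _  = contradiction refl w≢∞
  ⊙-cancelʳ {x} {y} (just w) _   eq =
    trans (sym (neg-cancel w x))
      (trans (cong (neg w +_) (trans (comm w x) (trans (just-injective eq) (comm y w)))) (neg-cancel w y))

  -- The image of π and its fibers.

  module _ {n r : ℕ} where

    Dr⇒FlDr : ∀ u → Ω n r u → Dr (suc n) (suc r) u → FlDr n r (πp u) (πq u)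
    Dr⇒FlDr u (ωp , ωq) (_ , gp) = ωp , ωq ,
      Rel⇒GP (λ A B ∣A∣ ∣B∣ → Rel-restrict u (inj₁ here) (rel (true ∷ A) (true ∷ B) (cong suc ∣A∣) (cong suc ∣B∣))) ,
      Rel⇒GP (λ A B ∣A∣ ∣B∣ → Rel-restrict u (inj₂ λ ()) (rel (false ∷ A) (false ∷ B) ∣A∣ ∣B∣)) ,
      Rel⇒IP (πp u) (πq u) (λ A B ∣A∣ ∣B∣ → Rel-restrict u (inj₁ here) (rel (true ∷ A) (false ∷ B) (cong suc ∣A∣) ∣B∣))
      where
      rel = GP⇒Rel gp

    module _ {μ′ μ : Vect n} (fl : FlDr n r μ′ μ) where
      private
        ωp = proj₁ fl
        ωq = proj₁ (proj₂ fl)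
        rel-μ′ = GP⇒Rel (proj₁ (proj₂ (proj₂ fl)))
        rel-μ  = GP⇒Rel (proj₁ (proj₂ (proj₂ (proj₂ fl))))
        rel-μ′μ = IP⇒Rel μ′ μ (proj₂ (proj₂ (proj₂ (proj₂ fl))))

      module _ (a b : Carrier) where
        private u = comb a b μ′ μ

        πp-comb : ∀ S → πp u S ≡ just a ⊙ μ′ S
        πp-comb S = ⊕-identityʳ (just a ⊙ μ′ S)

        πq-comb : ∀ S → πq u S ≡ just b ⊙ μ S
        πq-comb S = refl

        Ω-comb : Ω n r u
        Ω-comb = let S , ∣S∣ , fS = ωp ; T , ∣T∣ , fT = ωq in
          (S , ∣S∣ , ⊙-finite⁺ {just a} (λ ()) fS ∘ trans (sym (πp-comb S))) ,
          (T , ∣T∣ , ⊙-finite⁺ {just b} (λ ()) fT)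

        Dr-comb : Dr (suc n) (suc r) u
        Dr-comb = (let T , ∣T∣ , fT = proj₂ Ω-comb in false ∷ T , ∣T∣ , fT) ,
          Rel⇒GP λ A B ∣A∣ ∣B∣ → Extension.all-relations zero u known A B (ℕₚ.suc-injective ∣A∣) ∣B∣
          where
          -- The three relations of the flag, each with all terms shifted by one constant: a + a, a
          -- + b or b + b.
          known : ∀ A B → ∣ A ∣ ≡ r → ∣ B ∣ ≡ suc (suc r) → zero ∈ A ⊎ zero ∉ B → Rel u u A B
          known (true ∷ A) (true ∷ B) ∣A∣ ∣B∣ 0? = Rel-extend u 0?
            (Rel-scale a a πp-comb πp-comb (rel-μ′ A B ∣A∣ (ℕₚ.suc-injective ∣B∣)))
          known (true ∷ A) (false ∷ B) ∣A∣ ∣B∣ 0? = Rel-extend u 0?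
            (Rel-scale a b πp-comb πq-comb (rel-μ′μ A B ∣A∣ ∣B∣))
          known (false ∷ A) (false ∷ B) ∣A∣ ∣B∣ 0? = Rel-extend u 0?
            (Rel-scale b b πq-comb πq-comb (rel-μ A B (cong suc ∣A∣) ∣B∣))
          known (false ∷ A) (true ∷ B) ∣A∣ ∣B∣ (inj₂ 0∉) = contradiction here 0∉

        πp-comb≈ : πp u ≈[ r ] μ′
        πp-comb≈ = a , λ S _ → πp-comb S

        πq-comb≈ : πq u ≈[ suc r ] μ
        πq-comb≈ = b , λ S _ → πq-comb S

      -- The scalars relating the two blocks of `u` to μ′ and μ are a and b themselves, with overall
      -- scalar 0; conversely an overall scalar c is added to both.
      fiber : ∀ u → (πp u ≈[ r ] μ′ × πq u ≈[ suc r ] μ)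
            ⇔ Σ Carrier λ a → Σ Carrier λ b → u ≈[ suc r ] comb a b μ′ μ
      fiber u = mk⇔ to from
        where
        to : _ → _
        to ((a , eqp) , (b , eqq)) = a , b , 0# , λ
          { (true  ∷ S) ∣S∣ → trans (eqp S (ℕₚ.suc-injective ∣S∣)) (sym (trans (⊙-identityˡ _) (πp-comb a b S)))
          ; (false ∷ S) ∣S∣ → trans (eqq S ∣S∣) (sym (⊙-identityˡ _)) }
        from : _ → _
        from (a , b , c , eq) =
          (c + a , λ S ∣S∣ → trans (eq (true ∷ S) (cong suc ∣S∣))
                     (trans (cong (just c ⊙_) (πp-comb a b S)) (sym (⊙-assoc (just c) (just a) (μ′ S))))) ,
          (c + b , λ S ∣S∣ → trans (eq (false ∷ S) ∣S∣) (sym (⊙-assoc (just c) (just b) (μ S))))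

      -- Comparing values at a set where μ′ is finite and at one where μ is finite gives a = c + a′
      -- and b = c + b′ with the same c; hence the shift `neg c`.
      comb-injective : ∀ a b a′ b′ → (comb a b μ′ μ ≈[ suc r ] comb a′ b′ μ′ μ)
            ⇔ Σ Carrier λ c → a′ ≡ a + c × b′ ≡ b + c
      comb-injective a b a′ b′ = mk⇔ to from
        where
        shift : ∀ {x x′ c} → x ≡ c + x′ → x′ ≡ x + neg c
        shift {x} {x′} {c} refl = trans (sym (neg-cancel c x′)) (comm _ _)

        to : _ → _
        to (c , eq) = let S , ∣S∣ , fS = ωp ; T , ∣T∣ , fT = ωq in
          neg c ,
          shift (⊙-cancelʳ (μ′ S) fS (trans (sym (πp-comb a b S)) (trans (eq (true ∷ S) (cong suc ∣S∣))
            (trans (cong (just c ⊙_) (πp-comb a′ b′ S)) (sym (⊙-assoc (just c) (just a′) (μ′ S))))))) ,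
          shift (⊙-cancelʳ (μ T) fT (trans (eq (false ∷ T) ∣T∣) (sym (⊙-assoc (just c) (just b′) (μ T)))))

        unshift : ∀ x c w → just x ⊙ w ≡ just (neg c) ⊙ (just (x + c) ⊙ w)
        unshift x c w = trans (cong (λ y → just y ⊙ w) (sym (trans (cong (neg c +_) (comm x c)) (neg-cancel c x))))
          (⊙-assoc (just (neg c)) (just (x + c)) w)

        from : _ → _
        from (c , refl , refl) = neg c , λ
          { (true  ∷ S) _ → trans (πp-comb a b S) (trans (unshift a c (μ′ S))
                              (cong (just (neg c) ⊙_) (sym (πp-comb (a + c) (b + c) S))))
          ; (false ∷ S) _ → unshift b c (μ S) }

theorem5p2 : (G : LinOrdAbGroup) → let open Tropical G in
  (n r : ℕ) → r ℕ≤ n →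
  -- π maps Ω ∩ Dr(r+1; n+1) into FlDr(r, r+1; n)
  (∀ u → Ω n r u → Dr (suc n) (suc r) u → FlDr n r (πp u) (πq u))
  ×
  -- ... onto FlDr(r, r+1; n)
  (∀ μ′ μ → FlDr n r μ′ μ →
     Σ (Vect (suc n)) λ u → Ω n r u × Dr (suc n) (suc r) u
       × πp u ≈[ r ] μ′ × πq u ≈[ suc r ] μ)
  ×
  -- fibers
  (∀ μ′ μ → FlDr n r μ′ μ →
     -- a point of Ω ∩ Dr lies over (μ', μ) iff it is the class of some a ⊙ μ' ⊕ b ⊙ μ
     (∀ u → Ω n r u → Dr (suc n) (suc r) u →
        ((πp u ≈[ r ] μ′ × πq u ≈[ suc r ] μ)
          ⇔ Σ Carrier λ a → Σ Carrier λ b → u ≈[ suc r ] comb a b μ′ μ))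
     ×
     -- each a ⊙ μ' ⊕ b ⊙ μ lies in Ω ∩ Dr(r+1; n+1) and over (μ', μ)
     (∀ a b → Ω n r (comb a b μ′ μ) × Dr (suc n) (suc r) (comb a b μ′ μ)
        × πp (comb a b μ′ μ) ≈[ r ] μ′ × πq (comb a b μ′ μ) ≈[ suc r ] μ)
     ×
     -- (a, b) ↦ class is injective exactly modulo ℝ(1,1): fiber ≅ ℝ² / ℝ(1,1)
     (∀ a b a′ b′ →
        (comb a b μ′ μ ≈[ suc r ] comb a′ b′ μ′ μ)
          ⇔ Σ Carrier λ c → a′ ≡ a + c × b′ ≡ b + c))
theorem5p2 G n r _ =
  Dr⇒FlDr ,
  -- The preimage is the combination with a = b = 0.
  (λ μ′ μ fl → _ , over fl 0# 0#) ,
  (λ μ′ μ fl → (λ u _ _ → fiber fl u) , over fl , comb-injective fl)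
  where
  open Tropical G
  open TropicalExchange G
  over : ∀ {μ′ μ} → FlDr n r μ′ μ → ∀ a b →
         Ω n r (comb a b μ′ μ) × Dr (suc n) (suc r) (comb a b μ′ μ)
         × πp (comb a b μ′ μ) ≈[ r ] μ′ × πq (comb a b μ′ μ) ≈[ suc r ] μ
  over fl a b = Ω-comb fl a b , Dr-comb fl a b , πp-comb≈ fl a b , πq-comb≈ fl a b
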